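{- If $G$ is a tree, then $\pi_f(G)<\sqrt2$.
   Context: Two edges are nonincident if they share no endpoint. A linear ordering of $V(G)$ separates a pair of nonincident edges if both endpoints of one edge precede both endpoints of the other. $\pi_t(G)$ is the minimum length of a list of linear orderings of $V(G)$ (repetitions allowed) separating every pair of nonincident edges at least $t$ times ($0$ if there are no such pairs), and the fractional separation dimension is $\pi_f(G)=\liminf_{t\to\infty}\pi_t(G)/t$. -}

module Defs where

open import Level using (0ℓ)
open import Data.Nat using (ℕ; zero; suc; _+_; _*_; _≤_; _<_; _<ᵇ_; _⊔_; _⊓_)
open import Data.Fin using (Fin; toℕ)
open import Data.Fin.Permutation using (Permutation′; _⟨$⟩ʳ_)
open import Data.Bool using (Bool; true; false; if_then_else_; _∨_; _∧_)
open import Data.List using (List; []; _∷_; length; map)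
open import Data.List.Relation.Unary.Unique.Propositional using (Unique)
open import Data.Product using (Σ; ∃; _×_; _,_)
open import Relation.Binary.PropositionalEquality using (_≡_; _≢_)
open import Relation.Nullary using (¬_)
open import Data.Empty using (⊥)
open import Data.Nat.ListAction using (sum)

record Graph : Set₁ where
  field
    n     : ℕ
    Adj   : Fin n → Fin n → Set
    sym   : ∀ {u v} → Adj u v → Adj v u
    irrefl : ∀ {u} → ¬ Adj u u
open Graph public

data Walk (G : Graph) : Fin (n G) → Fin (n G) → Set where
  nil  : ∀ {u} → Walk G u u
  cons : ∀ {u v w} → Adj G u v → Walk G v w → Walk G u w

Connected : Graph → Set
Connected G = ∀ u v → Walk G u v

ChainTo : (G : Graph) → Fin (n G) → List (Fin (n G)) → Set
ChainTo G x []           = ⊥  -- empty chain: not used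
ChainTo G x (v ∷ [])     = Adj G v x
ChainTo G x (v ∷ w ∷ vs) = Adj G v w × ChainTo G x (w ∷ vs)

HasCycle : Graph → Set
HasCycle G = Σ (Fin (n G)) λ a → Σ (Fin (n G)) λ b → Σ (Fin (n G)) λ c →
             Σ (List (Fin (n G))) λ vs →
               Unique (a ∷ b ∷ c ∷ vs) × Adj G a b × ChainTo G a (b ∷ c ∷ vs)

IsTree : Graph → Set
IsTree G = (0 < n G) × Connected G × ¬ HasCycle G

Ordering : Graph → Set
Ordering G = Permutation′ (n G)

pos : {G : Graph} → Ordering G → Fin (n G) → ℕ
pos σ v = toℕ (σ ⟨$⟩ʳ v)

separates : {G : Graph} → Ordering G → (a b c d : Fin (n G)) → Bool
separates {G} σ a b c d =
  ((p a ⊔ p b) <ᵇ (p c ⊓ p d)) ∨ ((p c ⊔ p d) <ᵇ (p a ⊓ p b))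
  where p = pos {G} σ

sepCount : {G : Graph} → List (Ordering G) → (a b c d : Fin (n G)) → ℕ
sepCount {G} σs a b c d = sum (map (λ σ → if separates {G} σ a b c d then 1 else 0) σs)

SeparatesAll : (G : Graph) → ℕ → List (Ordering G) → Set
SeparatesAll G t σs = ∀ a b c d → Adj G a b → Adj G c d →
  a ≢ c → a ≢ d → b ≢ c → b ≢ d → t ≤ sepCount {G} σs a b c d

IsPiT : (G : Graph) → ℕ → ℕ → Set
IsPiT G t m = (Σ (List (Ordering G)) λ σs → length σs ≡ m × SeparatesAll G t σs)
            × (∀ σs → SeparatesAll G t σs → m ≤ length σs)

-- π_f(G) = liminf_t π_t(G)/t < p/q, written out: ∀ N ∃ t > N with π_t(G)/t < p/q.
-- π_f(G) < √2 iff some rational p/q with p² < 2q² satisfies this.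
FracSepLtSqrt2 : Graph → Set
FracSepLtSqrt2 G = Σ ℕ λ p → Σ ℕ λ q → (0 < q) × (p * p < 2 * (q * q)) ×
  (∀ N → Σ ℕ λ t → (N < t) × Σ ℕ λ m → IsPiT G t m × (m * q < p * t))

{-# OPTIONS --safe #-}
-- Root the tree and order each subtree as an interval, every child's subtree lying entirely to the
-- left or to the right of its parent. Independently for each vertex v with probability p, v lies on
-- the same side of its parent as the parent lies of the grandparent ("far"); a further fair coin
-- decides whether siblings on the same side appear by increasing or decreasing distance. Two edges
-- on a descending path are separated when a certain vertex is far, hence with probability p; an edge
-- from w to a child and an edge below another child are separated with probability at least
-- 1/2 + p (1 - p); other nonincident pairs always are. Both bounds equal 1/√2 at p = 1/√2. Turning
-- the outcome with no far vertex into the one with all vertices far does not affect the second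
-- bound and raises the first one to p + (1 - p)^N, so that a rational p = a / c slightly below 1/√2
-- makes both strictly larger than 1/√2; the solutions of 2 a² + 1 = c² provide such a p.
module Submission where

open import Defs hiding (sym)
open import Data.Bool using (Bool; true; false; not; _∨_; _xor_; if_then_else_)
open import Data.Bool.Properties using (∨-zeroʳ; T-≡)
open import Data.Fin using (Fin; zero; suc; toℕ; fromℕ<; opposite; punchIn)
open import Data.Fin.Permutation using (Permutation′; permutation; _⟨$⟩ʳ_; _≈_; insert; remove; insert-remove) renaming (id to idₚ)
open import Data.Fin.Properties using (_≟_; any?; all?; toℕ-injective; toℕ-fromℕ<; toℕ<n; punchOut-injective; injective⇒≤; opposite-prop; opposite-involutive)
import Data.Fin.Properties as Fin
open import Data.Integer as ℤ using (ℤ; 0ℤ; -[1+_]; +[1+_]; +<+; -<+; -<-)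
import Data.Integer.Properties as ℤ
open import Data.List using (List; []; _∷_; _∷ʳ_; _++_; map; concat; replicate; length; filter; allFin)
open import Data.List.Membership.DecPropositional using () renaming (_∈?_ to member?)
open import Data.List.Membership.Propositional using (_∈_; _∉_; lose)
open import Data.List.Membership.Propositional.Properties using (∈-allFin; ∈-++⁺ˡ; ∈-++⁺ʳ)
open import Data.List.Properties using (∷-injective; ∷ʳ-injectiveˡ; ≡-dec; filter-notAll; length-tabulate; map-++; map-∘; length-++; length-map)
open import Data.List.Relation.Binary.Lex.Strict using (Lex-<; this; next) renaming (<-strictTotalOrder to lex-strictTotalOrder)
open import Data.List.Relation.Binary.Pointwise using (Pointwise; []; _∷_; Pointwise-≡⇒≡)
open import Data.List.Relation.Unary.All as All using (All; []; _∷_)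
open import Data.List.Relation.Unary.All.Properties using (∷ʳ⁺)
open import Data.List.Relation.Unary.AllPairs using ([]; _∷_)
open import Data.List.Relation.Unary.Any using (here; there)
open import Data.List.Relation.Unary.Unique.Propositional using (Unique)
import Data.List.Relation.Unary.Unique.Propositional.Properties as Unique
open import Data.Nat using (ℕ; zero; suc; _+_; _*_; _^_; _⊔_; _⊓_; _<ᵇ_; _≤_; _<_; _≤?_; z≤n; s≤s; z<s; s<s; s≤s⁻¹; >-nonZero)
open import Data.Nat.ListAction using (sum)
open import Data.Nat.ListAction.Properties using (sum-++)
open import Data.Nat.Properties hiding (_≟_)
open import Data.Nat.Tactic.RingSolver using (solve-∀)
open import Data.Product using (Σ; ∃; _×_; _,_; proj₁; proj₂)
open import Data.Sum as Sum using (_⊎_; inj₁; inj₂; [_,_]′)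
open import Data.Vec using (Vec; []; _∷_; lookup)
open import Function using (_∘_; const; Injective; Equivalence)
open import Relation.Binary using (StrictTotalOrder; tri<; tri≈; tri>)
open import Relation.Binary.PropositionalEquality using (_≡_; _≢_; refl; sym; trans; cong; cong₂; subst; subst₂)
open import Relation.Nullary using (¬_; Dec; yes; no; contradiction)
open import Relation.Nullary.Decidable using (map′; _→-dec_; _⊎-dec_; ¬?)
open import Relation.Unary using (Decidable)

-- Approximating 1/√2 from below

-- The fraction a / (a + b) serves as the probability of being far. The Pell equation puts it just
-- below 1/√2, `b≤a` and `a≤3b` keep the two weights comparable, and `large` makes the defect small
-- against the gain from the outcome with no far vertex.
record PellPair (k : ℕ) : Set where
  field
    a b   : ℕ
    pell  : 2 * (a * a) + 1 ≡ (a + b) * (a + b)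
    0<b   : 0 < b
    b≤a   : b ≤ a
    a≤3b  : a ≤ 3 * b
    large : 2 ^ k ≤ a + b

-- In terms of c = a + b the step is (a , c) ↦ (3 a + 2 c , 4 a + 3 c).
pellPair : ∀ k → PellPair k
pellPair zero = record
  { a = 2 ; b = 1 ; pell = refl ; 0<b = z<s ; b≤a = s≤s z≤n
  ; a≤3b = s≤s (s≤s z≤n) ; large = s≤s z≤n }
pellPair (suc k) = record
  { a     = 5 * a + 2 * b
  ; b     = 2 * a + b
  -- With c = a + b, `step` says that c² - 2 a² is invariant, written without subtraction;
  -- cancelling the old c² leaves the new equation.
  ; pell  = +-cancelʳ-≡ ((a + b) * (a + b)) _ _
              (trans (step a b) (cong (λ z → (5 * a + 2 * b + (2 * a + b)) * (5 * a + 2 * b + (2 * a + b)) + z) pell))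
  ; 0<b   = ≤-trans 0<b (m≤n+m b (2 * a))
  ; b≤a   = +-mono-≤ (*-monoˡ-≤ a {2} {5} (s≤s (s≤s z≤n))) (m≤m+n b _)
  ; a≤3b  = subst (5 * a + 2 * b ≤_) (triple a b)
              (+-mono-≤ (*-monoˡ-≤ a {5} {6} (n≤1+n 5)) (*-monoˡ-≤ b {2} {3} (n≤1+n 2)))
  ; large = ≤-trans (*-monoʳ-≤ 2 large)
              (≤-trans (m≤m+n (2 * (a + b)) (5 * a + b)) (≤-reflexive (total a b)))
  }
  where
  open PellPair (pellPair k)
  step : ∀ a b → 2 * ((5 * a + 2 * b) * (5 * a + 2 * b)) + 1 + (a + b) * (a + b)
               ≡ (5 * a + 2 * b + (2 * a + b)) * (5 * a + 2 * b + (2 * a + b)) + (2 * (a * a) + 1)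
  step = solve-∀
  triple : ∀ a b → 6 * a + 3 * b ≡ 3 * (2 * a + b)
  triple = solve-∀
  total : ∀ a b → 2 * (a + b) + (5 * a + b) ≡ (5 * a + 2 * b) + (2 * a + b)
  total = solve-∀

square : ℕ → ℕ
square m = m * m

-- Applied with x = c^(1+n) and e = b^(2+n). By `pell` the left side is 8 a² x² + 4 x²; the cross
-- term 16 a x e on the right absorbs 4 x², and 8 e² gives strictness.
chainBound : ∀ a c x e → 2 * (a * a) + 1 ≡ c * c → x ≤ 4 * a * e → 0 < e →
             square (2 * (c * x)) < 2 * square (2 * (a * x + e))
chainBound a c x e pell x≤4ae 0<e = begin-strict
  square (2 * (c * x))                              ≡⟨ lhs c x ⟩
  4 * (c * c) * (x * x)                             ≡⟨ cong (λ z → 4 * z * (x * x)) pell ⟨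
  4 * (2 * (a * a) + 1) * (x * x)                   ≡⟨ mid a x ⟩
  8 * (a * a) * (x * x) + 4 * (x * x)               ≤⟨ +-monoʳ-≤ (8 * (a * a) * (x * x)) (*-monoʳ-≤ 4 (*-monoʳ-≤ x x≤4ae)) ⟩
  8 * (a * a) * (x * x) + 4 * (x * (4 * a * e))     ≡⟨ +-identityʳ _ ⟨
  8 * (a * a) * (x * x) + 4 * (x * (4 * a * e)) + 0 <⟨ +-monoʳ-< _ (*-mono-< (z<s {7}) (*-mono-< 0<e 0<e)) ⟩
  8 * (a * a) * (x * x) + 4 * (x * (4 * a * e)) + 8 * (e * e) ≡⟨ rhs a x e ⟩
  2 * square (2 * (a * x + e))                      ∎
  where
  open ≤-Reasoning
  lhs : ∀ c x → (2 * (c * x)) * (2 * (c * x)) ≡ 4 * (c * c) * (x * x)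
  lhs = solve-∀
  mid : ∀ a x → 4 * (2 * (a * a) + 1) * (x * x) ≡ 8 * (a * a) * (x * x) + 4 * (x * x)
  mid = solve-∀
  rhs : ∀ a x e → 8 * (a * a) * (x * x) + 4 * (x * (4 * a * e)) + 8 * (e * e) ≡ 2 * ((2 * (a * x + e)) * (2 * (a * x + e)))
  rhs = solve-∀

-- Applied with d = c^n. By `pell`, c² + 2 a b = 2 a c + 1, so everything reduces to 4 c² < 8 a c +
-- 2, which follows from c ≤ 2 a.
siblingBound : ∀ a b d → 2 * (a * a) + 1 ≡ (a + b) * (a + b) → b ≤ a → 0 < d →
               let c = a + b in
               square (2 * (c * (c * d))) < 2 * square (c * (c * d) + 2 * (a * b) * d)
siblingBound a b d pell b≤a 0<d = begin-strict
  square (2 * (c * (c * d)))                                   ≡⟨ lhs c d ⟩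
  4 * (c * c) * (c * c) * (d * d)                              ≡⟨ cong (λ z → 4 * (c * c) * z * (d * d)) pell ⟨
  4 * (c * c) * (2 * (a * a) + 1) * (d * d)                    ≡⟨ mid a c d ⟩
  (8 * (a * a) * (c * c) + 4 * c * c) * (d * d)                ≤⟨ *-monoˡ-≤ (d * d) (+-monoʳ-≤ (8 * (a * a) * (c * c)) (*-monoʳ-≤ (4 * c) (+-monoʳ-≤ a b≤a))) ⟩
  (8 * (a * a) * (c * c) + 4 * c * (a + a)) * (d * d)          ≡⟨ +-identityʳ _ ⟨
  (8 * (a * a) * (c * c) + 4 * c * (a + a)) * (d * d) + 0      <⟨ +-monoʳ-< _ (*-mono-< (z<s {1}) (*-mono-< 0<d 0<d)) ⟩
  (8 * (a * a) * (c * c) + 4 * c * (a + a)) * (d * d) + 2 * (d * d) ≡⟨ rhs a c d ⟩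
  2 * square ((2 * (a * c) + 1) * d)                           ≡⟨ cong (λ z → 2 * square (z * d)) (split a b) ⟩
  2 * square (((2 * (a * a) + 1) + 2 * (a * b)) * d)           ≡⟨ cong (λ z → 2 * square ((z + 2 * (a * b)) * d)) pell ⟩
  2 * square ((c * c + 2 * (a * b)) * d)                       ≡⟨ cong (λ z → 2 * square z) (distrib c (2 * (a * b)) d) ⟩
  2 * square (c * (c * d) + 2 * (a * b) * d)                   ∎
  where
  open ≤-Reasoning
  c = a + b
  lhs : ∀ c d → (2 * (c * (c * d))) * (2 * (c * (c * d))) ≡ 4 * (c * c) * (c * c) * (d * d)
  lhs = solve-∀
  mid : ∀ a c d → 4 * (c * c) * (2 * (a * a) + 1) * (d * d) ≡ (8 * (a * a) * (c * c) + 4 * c * c) * (d * d)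
  mid = solve-∀
  rhs : ∀ a c d → (8 * (a * a) * (c * c) + 4 * c * (a + a)) * (d * d) + 2 * (d * d)
                ≡ 2 * (((2 * (a * c) + 1) * d) * ((2 * (a * c) + 1) * d))
  rhs = solve-∀
  split : ∀ a b → 2 * (a * (a + b)) + 1 ≡ (2 * (a * a) + 1) + 2 * (a * b)
  split = solve-∀
  distrib : ∀ c y d → (c * c + y) * d ≡ c * (c * d) + y * d
  distrib = solve-∀

^-distribʳ-* : ∀ k x y → (x * y) ^ k ≡ x ^ k * y ^ k
^-distribʳ-* zero    x y = refl
^-distribʳ-* (suc k) x y = trans (cong (x * y *_) (^-distribʳ-* k x y)) (interchange x y (x ^ k) (y ^ k))
  where
  interchange : ∀ x y u v → x * y * (u * v) ≡ x * u * (y * v)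
  interchange = solve-∀

module _ {n : ℕ} (P : PellPair (2 + n)) where
  open PellPair P
  private c = a + b

  -- c ≤ 4 b gives 4^(n+2) b^(n+2) ≥ c^(n+2), and c² ≥ 4^(n+2).
  c^n≤b^n+2 : c ^ n ≤ b ^ (2 + n)
  c^n≤b^n+2 = *-cancelˡ-≤ (4 ^ (2 + n)) {{m^n≢0 4 (2 + n)}} (begin
    4 ^ (2 + n) * c ^ n          ≡⟨ cong (_* c ^ n) (^-distribʳ-* (2 + n) 2 2) ⟩
    2 ^ (2 + n) * 2 ^ (2 + n) * c ^ n ≤⟨ *-monoˡ-≤ (c ^ n) (*-mono-≤ large large) ⟩
    c * c * c ^ n                ≡⟨ *-assoc c c (c ^ n) ⟩
    c ^ (2 + n)                  ≤⟨ ^-monoˡ-≤ (2 + n) c≤4b ⟩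
    (4 * b) ^ (2 + n)            ≡⟨ ^-distribʳ-* (2 + n) 4 b ⟩
    4 ^ (2 + n) * b ^ (2 + n)    ∎)
    where
    open ≤-Reasoning
    c≤4b : c ≤ 4 * b
    c≤4b = ≤-trans (+-monoˡ-≤ b a≤3b) (≤-reflexive (+-comm (3 * b) b))

  c^1+n≤4ab^n+2 : c ^ (1 + n) ≤ 4 * a * b ^ (2 + n)
  c^1+n≤4ab^n+2 = *-mono-≤ c≤4a c^n≤b^n+2
    where
    c≤4a : c ≤ 4 * a
    c≤4a = +-monoʳ-≤ a (≤-trans b≤a (m≤m+n a _))

-- The fraction is L / t + 1 / (t X) with X = 2 + 2 L. Since X² = 2 L X + 2 X, its numerator
-- satisfies p² < (L² + 1) X², and L² + 1 ≤ 2 t² by integrality.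
between : ∀ L t → square L < 2 * square t →
          ∃ λ p → ∃ λ q → 0 < q × square p < 2 * square q × L * q < p * t
between L t L²<2t² = p , q , *-mono-< 0<t (z<s {1 + 2 * L}) , p²<2q² , Lq<pt
  where
  open ≤-Reasoning
  X = 2 + 2 * L
  p = L * X + 1
  q = t * X
  0<t : 0 < t
  0<t = n≢0⇒n>0 λ { refl → contradiction L²<2t² λ () }
  p²<2q² : square p < 2 * square q
  p²<2q² = begin-strict
    square p                        ≡⟨ eq₁ L X ⟩
    square L * square X + (2 * L * X + 1) <⟨ +-monoʳ-< (square L * square X) (+-monoʳ-< (2 * L * X) (*-mono-≤ {2} {2} ≤-refl (z<s {1 + 2 * L}))) ⟩
    square L * square X + (2 * L * X + 2 * X) ≡⟨ eq₃ L (square L) ⟩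
    suc (square L) * square X       ≤⟨ *-monoˡ-≤ (square X) L²<2t² ⟩
    2 * square t * square X         ≡⟨ eq₂ t X ⟩
    2 * square q                    ∎
    where
    eq₁ : ∀ L X → (L * X + 1) * (L * X + 1) ≡ L * L * (X * X) + (2 * L * X + 1)
    eq₁ = solve-∀
    eq₃ : ∀ L s → s * ((2 + 2 * L) * (2 + 2 * L)) + (2 * L * (2 + 2 * L) + 2 * (2 + 2 * L))
                ≡ suc s * ((2 + 2 * L) * (2 + 2 * L))
    eq₃ = solve-∀
    eq₂ : ∀ t X → 2 * (t * t) * (X * X) ≡ 2 * ((t * X) * (t * X))
    eq₂ = solve-∀
  Lq<pt : L * q < p * t
  Lq<pt = begin-strict
    L * q         ≡⟨ +-identityʳ _ ⟨
    L * q + 0     <⟨ +-monoʳ-< (L * q) 0<t ⟩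
    L * q + t     ≡⟨ eq L X t ⟩
    p * t         ∎
    where
    eq : ∀ L X t → L * (t * X) + t ≡ (L * X + 1) * t
    eq = solve-∀

-- Rooting the tree

-- The index lists the vertices of the path after its first one.
data Path (G : Graph) : Fin (n G) → Fin (n G) → List (Fin (n G)) → Set where
  end  : ∀ {u} → Path G u u []
  step : ∀ {u v w vs} → Adj G u v → Path G v w vs → Path G u w (v ∷ vs)

module _ {G : Graph} where
  private
    V = Fin (n G)

  Path-∷ʳ : ∀ {u v w vs} → Path G u v vs → Adj G v w → Path G u w (vs ∷ʳ w)
  Path-∷ʳ end        e′ = step e′ end
  Path-∷ʳ (step e p) e′ = step e (Path-∷ʳ p e′)

  Path⇒ChainTo : ∀ {u v x vs} → Path G u v vs → Adj G v x → ChainTo G x (u ∷ vs)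
  Path⇒ChainTo end                 e′ = e′
  Path⇒ChainTo (step e end)        e′ = e , e′
  Path⇒ChainTo (step e p@(step _ _)) e′ = e , Path⇒ChainTo p e′

  Unique-∷ʳ : ∀ {xs : List V} {x} → Unique xs → x ∉ xs → Unique (xs ∷ʳ x)
  Unique-∷ʳ xs! x∉xs = Unique.++⁺ xs! ([] ∷ []) λ { (x∈xs , here refl) → x∉xs x∈xs }

  SimplePath : List V → V → V → Set
  SimplePath S u v = ∃ λ vs → Path G u v vs × Unique (u ∷ vs) × All (_∈ S) (u ∷ vs)

  -- The path stays inside S and w lies outside, so putting w in front keeps the vertices distinct;
  -- u ≢ v guarantees at least three of them.
  closing-cycle : ∀ {S w u v} → w ∉ S → SimplePath S u v → u ≢ v →
                   Adj G w u → Adj G v w → HasCycle G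
  closing-cycle w∉S ([]     , end , _  , _   ) u≢v wu vw = contradiction refl u≢v
  closing-cycle {S} {w} {u} w∉S (x ∷ vs , p , u! , u∈S) u≢v wu vw =
    w , u , x , vs , All.map (λ y∈S w≡y → w∉S (subst (_∈ S) (sym w≡y) y∈S)) u∈S ∷ u! , wu , Path⇒ChainTo p vw

  -- rootPath v is the path from the root to v, without the root itself.
  record Subtree (S : List V) : Set where
    field
      connect      : ∀ {u v} → u ∈ S → v ∈ S → SimplePath S u v
      rootPath     : V → List V
      rootPath⊆    : ∀ {v} → v ∈ S → All (_∈ S) (rootPath v)
      rootPath-inj : ∀ {u v} → u ∈ S → v ∈ S → rootPath u ≡ rootPath v → u ≡ v
      child⇒adj    : ∀ {u v} → u ∈ S → v ∈ S → rootPath v ≡ rootPath u ∷ʳ v → Adj G u v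
      adj⇒child    : ∀ {u v} → u ∈ S → v ∈ S → Adj G u v →
                     rootPath v ≡ rootPath u ∷ʳ v ⊎ rootPath u ≡ rootPath v ∷ʳ u

  []≢∷ʳ : ∀ {xs : List V} {x} → [] ≢ xs ∷ʳ x
  []≢∷ʳ {[]}    ()
  []≢∷ʳ {_ ∷ _} ()

  ≢∷ʳ : ∀ (xs : List V) {x} → xs ≢ xs ∷ʳ x
  ≢∷ʳ []       ()
  ≢∷ʳ (x ∷ xs) eq = ≢∷ʳ xs (proj₂ (∷-injective eq))

  singleton : ∀ r → Subtree (r ∷ [])
  singleton r = record
    { connect      = λ { (here refl) (here refl) → [] , end , [] ∷ [] , here refl ∷ [] }
    ; rootPath     = λ _ → []
    ; rootPath⊆    = λ _ → []
    ; rootPath-inj = λ { (here refl) (here refl) _ → refl }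
    ; child⇒adj    = λ { {v = v} _ _ eq → contradiction eq ([]≢∷ʳ {[]} {v}) }
    ; adj⇒child    = λ { (here refl) (here refl) e → contradiction e (irrefl G) }
    }

  module _ (acyclic : ¬ HasCycle G) where

    -- The vertex w becomes a leaf below p. Old root paths stay inside S, so the presence of w tells
    -- the new root path from them. Acyclicity enters through `only-parent`.
    attach : ∀ {S p w} → Subtree S → p ∈ S → w ∉ S → Adj G p w → Subtree (w ∷ S)
    attach {S} {p} {w} T p∈S w∉S pw = record
      { connect      = connect′
      ; rootPath     = path
      ; rootPath⊆    = path⊆
      ; rootPath-inj = path-inj
      ; child⇒adj    = path-child⇒adj
      ; adj⇒child    = path-adj⇒child
      }
      where
      open Subtree T
      wp = Graph.sym G pw

      weaken : ∀ {vs} → All (_∈ S) vs → All (_∈ w ∷ S) vs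
      weaken = All.map there

      ∈⇒≢w : ∀ {v} → v ∈ S → v ≢ w
      ∈⇒≢w v∈S refl = w∉S v∈S

      connect′ : ∀ {u v} → u ∈ w ∷ S → v ∈ w ∷ S → SimplePath (w ∷ S) u v
      connect′ (here refl) (here refl) = [] , end , [] ∷ [] , here refl ∷ []
      connect′ (here refl) (there v∈S) with vs , π , vs! , vs∈S ← connect p∈S v∈S =
        _ , step wp π , All.map (λ x∈S w≡x → ∈⇒≢w x∈S (sym w≡x)) vs∈S ∷ vs! , here refl ∷ weaken vs∈S
      connect′ (there u∈S) (here refl) with vs , π , vs! , vs∈S ← connect u∈S p∈S =
        _ , Path-∷ʳ π pw , Unique-∷ʳ vs! (λ w∈vs → w∉S (All.lookup vs∈S w∈vs)) , ∷ʳ⁺ (weaken vs∈S) (here refl)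
      connect′ (there u∈S) (there v∈S) with vs , π , vs! , vs∈S ← connect u∈S v∈S =
        vs , π , vs! , weaken vs∈S

      path : V → List V
      path v with v ≟ w
      ... | yes _ = rootPath p ∷ʳ w
      ... | no  _ = rootPath v

      path-w : path w ≡ rootPath p ∷ʳ w
      path-w with w ≟ w
      ... | yes _   = refl
      ... | no  w≢w = contradiction refl w≢w

      path-old : ∀ {v} → v ∈ S → path v ≡ rootPath v
      path-old {v} v∈S with v ≟ w
      ... | yes v≡w = contradiction v≡w (∈⇒≢w v∈S)
      ... | no  _   = refl

      path⊆ : ∀ {v} → v ∈ w ∷ S → All (_∈ w ∷ S) (path v)
      path⊆ (here refl) rewrite path-w       = ∷ʳ⁺ (weaken (rootPath⊆ p∈S)) (here refl)
      path⊆ (there v∈S) rewrite path-old v∈S = weaken (rootPath⊆ v∈S)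

      w∉rootPath : ∀ {v} → v ∈ S → w ∉ rootPath v
      w∉rootPath v∈S w∈ = w∉S (All.lookup (rootPath⊆ v∈S) w∈)

      w∈∷ʳ : ∀ xs → w ∈ xs ∷ʳ w
      w∈∷ʳ xs = ∈-++⁺ʳ xs (here refl)

      path-inj : ∀ {u v} → u ∈ w ∷ S → v ∈ w ∷ S → path u ≡ path v → u ≡ v
      path-inj (here refl) (here refl) _ = refl
      path-inj (here refl) (there v∈S) eq rewrite path-w | path-old v∈S =
        contradiction (subst (w ∈_) eq (w∈∷ʳ _)) (w∉rootPath v∈S)
      path-inj (there u∈S) (here refl) eq rewrite path-w | path-old u∈S =
        contradiction (subst (w ∈_) (sym eq) (w∈∷ʳ _)) (w∉rootPath u∈S)
      path-inj (there u∈S) (there v∈S) eq rewrite path-old u∈S | path-old v∈S = rootPath-inj u∈S v∈S eq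

      path-child⇒adj : ∀ {u v} → u ∈ w ∷ S → v ∈ w ∷ S → path v ≡ path u ∷ʳ v → Adj G u v
      path-child⇒adj (here refl) (here refl) eq = contradiction eq (≢∷ʳ _)
      path-child⇒adj (here refl) (there v∈S) eq rewrite path-w | path-old v∈S =
        contradiction (subst (w ∈_) (sym eq) (∈-++⁺ˡ (w∈∷ʳ (rootPath p)))) (w∉rootPath v∈S)
      path-child⇒adj (there u∈S) (here refl) eq rewrite path-w | path-old u∈S =
        subst (λ x → Adj G x w) (rootPath-inj p∈S u∈S (∷ʳ-injectiveˡ _ _ eq)) pw
      path-child⇒adj (there u∈S) (there v∈S) eq rewrite path-old u∈S | path-old v∈S = child⇒adj u∈S v∈S eq

      -- A second neighbour v of w in S would close a cycle through w and the path from p to v.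
      only-parent : ∀ {v} → v ∈ S → Adj G v w → v ≡ p
      only-parent {v} v∈S vw with v ≟ p
      ... | yes v≡p = v≡p
      ... | no  v≢p = contradiction
        (closing-cycle w∉S (connect p∈S v∈S) (λ p≡v → v≢p (sym p≡v)) wp vw) acyclic

      path-adj⇒child : ∀ {u v} → u ∈ w ∷ S → v ∈ w ∷ S → Adj G u v →
                       path v ≡ path u ∷ʳ v ⊎ path u ≡ path v ∷ʳ u
      path-adj⇒child (here refl) (here refl) e = contradiction e (irrefl G)
      path-adj⇒child (here refl) (there v∈S) e rewrite path-w | path-old v∈S =
        inj₂ (cong (λ x → rootPath x ∷ʳ w) (sym (only-parent v∈S (Graph.sym G e))))
      path-adj⇒child (there u∈S) (here refl) e rewrite path-w | path-old u∈S =
        inj₁ (cong (λ x → rootPath x ∷ʳ w) (sym (only-parent u∈S e)))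
      path-adj⇒child (there u∈S) (there v∈S) e rewrite path-old u∈S | path-old v∈S = adj⇒child u∈S v∈S e

    Extension : List V → (V → Set) → Set
    Extension S P = ∃ λ S′ → Subtree S′ × (∀ {u} → u ∈ S → u ∈ S′) × (∀ {v} → P v → v ∈ S′)

    -- Each vertex of the walk that is still missing is attached to its predecessor, which has
    -- already been absorbed.
    extend-walk : ∀ {S u v} → Subtree S → u ∈ S → Walk G u v → Extension S (_≡ v)
    extend-walk T u∈S nil = _ , T , (λ x∈S → x∈S) , λ { refl → u∈S }
    extend-walk {S} T u∈S (cons {v = x} e walk) with member? _≟_ x S
    ... | yes x∈S = extend-walk T x∈S walk
    ... | no  x∉S with S′ , T′ , S⊆S′ , ∈S′ ← extend-walk (attach T u∈S x∉S e) (here refl) walk =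
      S′ , T′ , (λ y∈S → S⊆S′ (there y∈S)) , ∈S′

    extend-list : Connected G → ∀ {S r} → Subtree S → r ∈ S → ∀ vs → Extension S (_∈ vs)
    extend-list conn T r∈S [] = _ , T , (λ x∈S → x∈S) , λ ()
    extend-list conn {r = r} T r∈S (v ∷ vs)
      with S₁ , T₁ , S⊆S₁ , v∈S₁ ← extend-walk T r∈S (conn r v)
      with S₂ , T₂ , S₁⊆S₂ , vs⊆S₂ ← extend-list conn T₁ (S⊆S₁ r∈S) vs =
      S₂ , T₂ , (λ x∈S → S₁⊆S₂ (S⊆S₁ x∈S)) ,
      λ { (here refl) → S₁⊆S₂ (v∈S₁ refl) ; (there x∈vs) → vs⊆S₂ x∈vs }

record Rooting (G : Graph) : Set where
  field
    rootPath     : Fin (n G) → List (Fin (n G))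
    rootPath-inj : ∀ {u v} → rootPath u ≡ rootPath v → u ≡ v
    child⇒adj    : ∀ {u v} → rootPath v ≡ rootPath u ∷ʳ v → Adj G u v
    adj⇒child    : ∀ {u v} → Adj G u v → rootPath v ≡ rootPath u ∷ʳ v ⊎ rootPath u ≡ rootPath v ∷ʳ u

  -- Adjacency is given as an arbitrary type; comparing root paths decides it, and this makes the
  -- search for a shortest list of orderings possible.
  adj? : ∀ u v → Dec (Adj G u v)
  adj? u v = map′ (λ { (inj₁ eq) → child⇒adj eq ; (inj₂ eq) → Graph.sym G (child⇒adj eq) }) adj⇒child
    (≡-dec _≟_ (rootPath v) (rootPath u ∷ʳ v) ⊎-dec ≡-dec _≟_ (rootPath u) (rootPath v ∷ʳ u))

vertex : ∀ {n} → 0 < n → Fin n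
vertex {suc n} _ = zero

rooting : ∀ G → IsTree G → Rooting G
rooting G (0<n , conn , acyclic)
  with S , T , _ , ∈S ← extend-list acyclic conn (singleton (vertex 0<n)) (here refl) (allFin (n G)) = record
  { rootPath     = rootPath
  ; rootPath-inj = rootPath-inj (all _) (all _)
  ; child⇒adj    = child⇒adj (all _) (all _)
  ; adj⇒child    = adj⇒child (all _) (all _)
  }
  where
  open Subtree T
  all : ∀ v → v ∈ S
  all v = ∈S (∈-allFin v)

-- Orderings from lexicographic keys

module _ {a p q} {A : Set a} {P : A → Set p} {Q : A → Set q} (P? : Decidable P) (Q? : Decidable Q) (P⊆Q : ∀ {x} → P x → Q x) where

  length-filter-mono : ∀ xs → length (filter P? xs) ≤ length (filter Q? xs)
  length-filter-mono [] = z≤n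
  length-filter-mono (x ∷ xs) with ih ← length-filter-mono xs | P? x | Q? x
  ... | yes _  | yes _  = s≤s ih
  ... | yes px | no ¬qx = contradiction (P⊆Q px) ¬qx
  ... | no _   | yes _  = m≤n⇒m≤1+n ih
  ... | no _   | no _   = ih

  length-filter-strict : ∀ {x xs} → x ∈ xs → ¬ P x → Q x → length (filter P? xs) < length (filter Q? xs)
  length-filter-strict {xs = x ∷ xs} (here refl) ¬px qx with P? x | Q? x
  ... | yes px | _      = contradiction px ¬px
  ... | no _   | no ¬qx = contradiction qx ¬qx
  ... | no _   | yes _  = s≤s (length-filter-mono xs)
  length-filter-strict {xs = y ∷ xs} (there x∈xs) ¬px qx
    with ih ← length-filter-strict x∈xs ¬px qx | P? y | Q? y
  ... | yes _  | yes _  = s≤s ih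
  ... | yes py | no ¬qy = contradiction (P⊆Q py) ¬qy
  ... | no _   | yes _  = m≤n⇒m≤1+n ih
  ... | no _   | no _   = ih

-- Pigeonhole: a missed value y could be punched out, giving an injection into a smaller finite set.
injective⇒surjective : ∀ {n} (f : Fin n → Fin n) → Injective _≡_ _≡_ f → ∀ y → ∃ λ x → f x ≡ y
injective⇒surjective {suc n} f inj y with any? (λ x → f x ≟ y)
... | yes p = p
... | no ¬p = contradiction (injective⇒≤ (λ {x} {x′} → inj ∘ punchOut-injective (avoid x) (avoid x′))) 1+n≰n
  where
  avoid : ∀ x → y ≢ f x
  avoid x y≡fx = ¬p (x , sym y≡fx)

injective⇒permutation : ∀ {n} (f : Fin n → Fin n) → Injective _≡_ _≡_ f → Permutation′ n
injective⇒permutation f inj =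
  permutation f (proj₁ ∘ preimage) (proj₂ ∘ preimage) (λ x → inj (proj₂ (preimage (f x))))
  where
  preimage = injective⇒surjective f inj

-- A vertex is placed at the number of vertices with smaller keys, so comparing keys amounts to
-- comparing positions.
module Ranking {k ℓ₁ ℓ₂} (O : StrictTotalOrder k ℓ₁ ℓ₂) {n : ℕ} (key : Fin n → StrictTotalOrder.Carrier O)
               (key-inj : ∀ {u v} → StrictTotalOrder._≈_ O (key u) (key v) → u ≡ v) where
  open StrictTotalOrder O using (compare) renaming (_<_ to _≺_; _<?_ to _≺?_; irrefl to ≺-irrefl; trans to ≺-trans; module Eq to ≈)

  below : Fin n → List (Fin n)
  below v = filter (λ u → key u ≺? key v) (allFin n)

  below-strict : ∀ {u v} → key u ≺ key v → length (below u) < length (below v)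
  below-strict {u} u≺v =
    length-filter-strict _ _ (λ x≺u → ≺-trans x≺u u≺v) (∈-allFin u) (≺-irrefl ≈.refl) u≺v

  below-bounded : ∀ v → length (below v) < n
  below-bounded v = subst (length (below v) <_) (length-tabulate (λ x → x))
    (filter-notAll _ (allFin n) (lose (∈-allFin v) (≺-irrefl ≈.refl)))

  rank : Fin n → Fin n
  rank v = fromℕ< (below-bounded v)

  toℕ-rank : ∀ v → toℕ (rank v) ≡ length (below v)
  toℕ-rank v = toℕ-fromℕ< (below-bounded v)

  rank-mono : ∀ {u v} → key u ≺ key v → toℕ (rank u) < toℕ (rank v)
  rank-mono {u} {v} u≺v = subst₂ _<_ (sym (toℕ-rank u)) (sym (toℕ-rank v)) (below-strict u≺v)

  rank-inj : Injective _≡_ _≡_ rank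
  rank-inj {u} {v} eq with compare (key u) (key v)
  ... | tri< u≺v _ _ = contradiction (cong toℕ eq) (<⇒≢ (rank-mono u≺v))
  ... | tri≈ _ u≈v _ = key-inj u≈v
  ... | tri> _ _ v≺u = contradiction (cong toℕ (sym eq)) (<⇒≢ (rank-mono v≺u))

  ranking : Permutation′ n
  ranking = injective⇒permutation rank rank-inj

-- Token sequences of root paths and the relative position of two edges

tok : Bool → ℕ → ℤ
-- The sign is the side of the parent. The shift by one keeps `0ℤ` free for the parent itself, and a
-- larger index is farther from it on either side.
tok true  i = +[1+ i ]
tok false i = -[1+ i ]

tok-injective : ∀ s t {i j} → tok s i ≡ tok t j → s ≡ t × i ≡ j
tok-injective true  true  refl = refl , refl
tok-injective false false refl = refl , refl

-- The side of a vertex relative to its parent, from that of the parent and from whether it is far.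
side : Bool → Bool → Bool
side s true  = s
side s false = not s

side-injective : ∀ s {x y} → side s x ≡ side s y → x ≡ y
side-injective s {true}  {true}  eq = refl
side-injective s {false} {false} eq = refl
side-injective true  {true}  {false} ()
side-injective true  {false} {true} ()
side-injective false {true}  {false} ()
side-injective false {false} {true} ()

infix 4 _<ₗ_
_<ₗ_ : List ℤ → List ℤ → Set
_<ₗ_ = Lex-< _≡_ ℤ._<_

Below : (p₁ p₂ r₁ r₂ : List ℤ) → Set
Below p₁ p₂ r₁ r₂ = (p₁ <ₗ r₁ × p₁ <ₗ r₂) × (p₂ <ₗ r₁ × p₂ <ₗ r₂)

Apart : (p₁ p₂ r₁ r₂ : List ℤ) → Set
Apart p₁ p₂ r₁ r₂ = Below p₁ p₂ r₁ r₂ ⊎ Below r₁ r₂ p₁ p₂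

Below-∷ : ∀ {x p₁ p₂ r₁ r₂} → Below p₁ p₂ r₁ r₂ → Below (x ∷ p₁) (x ∷ p₂) (x ∷ r₁) (x ∷ r₂)
Below-∷ ((a , b) , (c , d)) = (next refl a , next refl b) , (next refl c , next refl d)

Below-heads : ∀ {x₁ x₂ y₁ y₂ p₁ p₂ r₁ r₂} →
  (x₁ ℤ.< y₁ × x₁ ℤ.< y₂) → (x₂ ℤ.< y₁ × x₂ ℤ.< y₂) →
  Below (x₁ ∷ p₁) (x₂ ∷ p₂) (y₁ ∷ r₁) (y₂ ∷ r₂)
Below-heads (a , b) (c , d) = (this a , this b) , (this c , this d)

-- That is, u misses the interval spanned by 0 and t. After the common prefix, an edge from a vertex
-- to its child reads 0 and t, while both ends of an edge below another child read u.
Outside : ℤ → ℤ → Set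
Outside t u = (0ℤ ℤ.< u × t ℤ.< u) ⊎ (u ℤ.< 0ℤ × u ℤ.< t)

Outside⇒Apart : ∀ {t u p₁ p₂ r₁ r₂} → Outside t u → Apart (0ℤ ∷ p₁) (t ∷ p₂) (u ∷ r₁) (u ∷ r₂)
Outside⇒Apart (inj₁ (0<u , t<u)) = inj₁ (Below-heads (0<u , 0<u) (t<u , t<u))
Outside⇒Apart (inj₂ (u<0 , u<t)) = inj₂ (Below-heads (u<0 , u<t) (u<0 , u<t))

outside-≢ : ∀ s t {i j} → s ≢ t → Outside (tok s i) (tok t j)
outside-≢ true  true  s≢t = contradiction refl s≢t
outside-≢ true  false _   = inj₂ (-<+ , -<+)
outside-≢ false true  _   = inj₁ (+<+ z<s , -<+)
outside-≢ false false s≢t = contradiction refl s≢t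

outside-< : ∀ s t {i j} → i < j → Outside (tok s i) (tok t j)
outside-< true  true  i<j = inj₁ (+<+ z<s , +<+ (s<s i<j))
outside-< true  false _   = inj₂ (-<+ , -<+)
outside-< false true  _   = inj₁ (+<+ z<s , -<+)
outside-< false false i<j = inj₂ (-<+ , -<- i<j)

module _ {n : ℕ} where
  private
    V = Fin n

  -- The fair coin: its two values rank siblings on the same side in opposite orders of distance.
  index : Bool → V → ℕ
  index true  v = toℕ v
  index false v = toℕ (opposite v)

  index-injective : ∀ d {u v} → index d u ≡ index d v → u ≡ v
  index-injective true  eq = toℕ-injective eq
  index-injective false {u} {v} eq = trans (sym (opposite-involutive u))
    (trans (cong opposite (toℕ-injective eq)) (opposite-involutive v))

  index-< : ∀ {u v} → u ≢ v → ∃ λ d → index d u < index d v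
  index-< {u} {v} u≢v with <-cmp (toℕ u) (toℕ v)
  ... | tri< u<v _ _ = true , u<v
  ... | tri≈ _ u≡v _ = contradiction (toℕ-injective u≡v) u≢v
  ... | tri> _ _ v<u = false , subst₂ _<_ (sym (opposite-prop u)) (sym (opposite-prop v))
                                 (∸-monoʳ-< (s<s v<u) (toℕ<n u))

  module _ (far : V → Bool) (d : Bool) where

    -- The terminating 0 puts a vertex between its left and right subtrees.
    tokens : Bool → List V → List ℤ
    tokens s []       = 0ℤ ∷ []
    tokens s (v ∷ vs) = tok (side s (far v)) (index d v) ∷ tokens (side s (far v)) vs

    tokens-injective : ∀ s {p r} → tokens s p ≡ tokens s r → p ≡ r
    tokens-injective s {[]}    {[]}    _  = refl
    -- The token of v is nonzero for either sign, which becomes visible once the side is split.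
    tokens-injective s {[]}    {v ∷ r} eq with side s (far v)
    tokens-injective s {[]}    {v ∷ r} () | true
    tokens-injective s {[]}    {v ∷ r} () | false
    tokens-injective s {u ∷ p} {[]}    eq with side s (far u)
    tokens-injective s {u ∷ p} {[]}    () | true
    tokens-injective s {u ∷ p} {[]}    () | false
    tokens-injective s {u ∷ p} {v ∷ r} eq
      with eqₕ , eqₜ ← ∷-injective eq
      with refl ← index-injective d (proj₂ (tok-injective (side s (far u)) (side s (far v)) eqₕ)) =
      cong (u ∷_) (tokens-injective (side s (far u)) eqₜ)

    Sep : Bool → (p₁ p₂ r₁ r₂ : List V) → Set
    Sep s p₁ p₂ r₁ r₂ = Apart (tokens s p₁) (tokens s p₂) (tokens s r₁) (tokens s r₂)

  -- In a `chain` the vertex z being far suffices for either coin. For a `sibling` pair, x and y on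
  -- opposite sides suffice for either coin, and one value of the coin suffices always. Pairs that
  -- are separated in every outcome are filed under `sibling`.
  data Config (p₁ p₂ r₁ r₂ : List V) : Set where
    chain   : ∀ z → (∀ far d s → far z ≡ true → Sep far d s p₁ p₂ r₁ r₂) → Config p₁ p₂ r₁ r₂
    sibling : ∀ x y → x ≢ y →
              (∀ far d s → far x ≢ far y → Sep far d s p₁ p₂ r₁ r₂) →
              ∀ d → (∀ far s → Sep far d s p₁ p₂ r₁ r₂) → Config p₁ p₂ r₁ r₂

  -- A common first vertex contributes the same token to all four keys and only changes the incoming
  -- side, over which `Config` quantifies.
  Config-∷ : ∀ v {p₁ p₂ r₁ r₂} → Config p₁ p₂ r₁ r₂ → Config (v ∷ p₁) (v ∷ p₂) (v ∷ r₁) (v ∷ r₂)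
  Config-∷ v (chain z sep) = chain z λ far d s fz → Sum.map Below-∷ Below-∷ (sep far d _ fz)
  Config-∷ v (sibling x y x≢y sep d sep-d) = sibling x y x≢y
    (λ far d s f≢ → Sum.map Below-∷ Below-∷ (sep far d _ f≢)) d
    (λ far s → Sum.map Below-∷ Below-∷ (sep-d far _))

  Config-swap : ∀ {p₁ p₂ r₁ r₂} → Config p₁ p₂ r₁ r₂ → Config r₁ r₂ p₁ p₂
  Config-swap (chain z sep) = chain z λ far d s fz → Sum.swap (sep far d s fz)
  Config-swap (sibling x y x≢y sep d sep-d) = sibling x y x≢y
    (λ far d s f≢ → Sum.swap (sep far d s f≢)) d (λ far s → Sum.swap (sep-d far s))

  -- If z is far, its subtree lies beyond x as seen from the parent of x, hence beyond both ends of
  -- the upper edge.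
  chain-Sep : ∀ far d s x z {r₁ r₂} → far z ≡ true → Sep far d s [] (x ∷ []) (x ∷ z ∷ r₁) (x ∷ z ∷ r₂)
  chain-Sep far d s x z fz rewrite fz with side s (far x)
  ... | true  = inj₁ ((this (+<+ z<s) , this (+<+ z<s)) , (next refl (this (+<+ z<s)) , next refl (this (+<+ z<s))))
  ... | false = inj₂ ((this -<+ , next refl (this -<+)) , (this -<+ , next refl (this -<+)))

  -- Subtrees of distinct siblings occupy disjoint intervals, since their first tokens differ.
  branch-Sep : ∀ far d s {x y p₁ p₂ r₁ r₂} → x ≢ y → Sep far d s (x ∷ p₁) (x ∷ p₂) (y ∷ r₁) (y ∷ r₂)
  branch-Sep far d s {x} {y} x≢y with ℤ.<-cmp (tok (side s (far x)) (index d x)) (tok (side s (far y)) (index d y))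
  ... | tri< lt _ _ = inj₁ (Below-heads (lt , lt) (lt , lt))
  ... | tri≈ _ eq _ = contradiction (index-injective d (proj₂ (tok-injective (side s (far x)) (side s (far y)) eq))) x≢y
  ... | tri> _ _ gt = inj₂ (Below-heads (gt , gt) (gt , gt))

  root-config : ∀ x y r v → x ∷ [] ≢ y ∷ r → Config [] (x ∷ []) (y ∷ r) (y ∷ r ∷ʳ v)
  root-config x y r v ≢ with x ≟ y
  root-config x y []      v ≢ | yes refl = contradiction refl ≢
  root-config x y (z ∷ r) v ≢ | yes refl = chain z λ far d s → chain-Sep far d s x z
  -- If exactly one of x and y is far, they lie on opposite sides of their parent. The coin d₀ puts
  -- x nearer than y, so that the subtree of y stays outside the edge to x even on the same side.
  root-config x y r       v ≢ | no x≢y with d₀ , x<y ← index-< x≢y = sibling x y x≢y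
    (λ far d s f≢ → Outside⇒Apart (outside-≢ (side s (far x)) (side s (far y)) (f≢ ∘ side-injective s)))
    d₀
    (λ far s → Outside⇒Apart (outside-< (side s (far x)) (side s (far y)) x<y))

  -- The common prefix is stripped until one upper endpoint is reached, which leaves `root-config`,
  -- or the two root paths diverge.
  config : ∀ p x r y → p ≢ r → p ∷ʳ x ≢ r → r ∷ʳ y ≢ p → Config p (p ∷ʳ x) r (r ∷ʳ y)
  config []      x []      y p≢r _ _ = contradiction refl p≢r
  config []      x (v ∷ r) y _ ≢ _ = root-config x v r y ≢
  config (u ∷ p) x []      y _ _ ≢ = Config-swap (root-config y u p x ≢)
  config (u ∷ p) x (v ∷ r) y p≢r px≢r ry≢p with u ≟ v
  ... | yes refl = Config-∷ u (config p x r y (p≢r ∘ cong (u ∷_)) (px≢r ∘ cong (u ∷_)) (ry≢p ∘ cong (u ∷_)))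
  -- The paths diverge above both edges, so every outcome separates them and the coin `true` is an
  -- arbitrary choice.
  ... | no u≢v   = sibling u v u≢v (λ far d s _ → branch-Sep far d s u≢v) true (λ far s → branch-Sep far true s u≢v)

-- The probability space

∑ : ∀ {A : Set} → (A → ℕ) → List A → ℕ
∑ f xs = sum (map f xs)

copies : ∀ {A : Set} → ℕ → List A → List A
copies k xs = concat (replicate k xs)

module _ {A : Set} where

  ∑-++ : ∀ (f : A → ℕ) xs ys → ∑ f (xs ++ ys) ≡ ∑ f xs + ∑ f ys
  ∑-++ f xs ys = trans (cong sum (map-++ f xs ys)) (sum-++ (map f xs) (map f ys))

  ∑-copies : ∀ (f : A → ℕ) k xs → ∑ f (copies k xs) ≡ k * ∑ f xs
  ∑-copies f zero    xs = refl
  ∑-copies f (suc k) xs = trans (∑-++ f xs _) (cong (∑ f xs +_) (∑-copies f k xs))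

  length-copies : ∀ k (xs : List A) → length (copies k xs) ≡ k * length xs
  length-copies zero    xs = refl
  length-copies (suc k) xs = trans (length-++ xs) (cong (length xs +_) (length-copies k xs))

  ∑-mono : ∀ {f g : A → ℕ} → (∀ x → f x ≤ g x) → ∀ xs → ∑ f xs ≤ ∑ g xs
  ∑-mono f≤g []       = z≤n
  ∑-mono f≤g (x ∷ xs) = +-mono-≤ (f≤g x) (∑-mono f≤g xs)

  ∑-+ : ∀ (f g : A → ℕ) xs → ∑ (λ x → f x + g x) xs ≡ ∑ f xs + ∑ g xs
  ∑-+ f g []       = refl
  ∑-+ f g (x ∷ xs) = trans (cong (f x + g x +_) (∑-+ f g xs)) (interchange (f x) (g x) (∑ f xs) (∑ g xs))
    where
    interchange : ∀ a b c d → a + b + (c + d) ≡ a + c + (b + d)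
    interchange = solve-∀

  ∑-const-1 : ∀ (xs : List A) → ∑ (const 1) xs ≡ length xs
  ∑-const-1 []       = refl
  ∑-const-1 (x ∷ xs) = cong suc (∑-const-1 xs)

∑-map : ∀ {A B : Set} (f : B → ℕ) (g : A → B) xs → ∑ f (map g xs) ≡ ∑ (f ∘ g) xs
∑-map f g xs = cong sum (sym (map-∘ xs))

𝟙 : Bool → ℕ
𝟙 x = if x then 1 else 0

none : ∀ {k} → Vec Bool k → Bool
none []          = true
none (true  ∷ ω) = false
none (false ∷ ω) = none ω

none⇒false : ∀ {k} (ω : Vec Bool k) → none ω ≡ true → ∀ i → lookup ω i ≡ false
none⇒false (false ∷ ω) eq zero    = refl
none⇒false (false ∷ ω) eq (suc i) = none⇒false ω eq i

module Outcomes (a b : ℕ) where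
  private
    c = a + b

    total : ∀ a b x y → a * (x * y) + b * (x * y) ≡ x * ((a + b) * y)
    total = solve-∀

    mixed : ∀ a b y → a * ((a * 0 + b * 1) * y) + b * ((a * 1 + b * 0) * y) ≡ 2 * (a * b) * y
    mixed = solve-∀

  -- The product measure with probability a / c for `true`, scaled by c^k: a vector occurs with
  -- multiplicity a to the number of its `true` entries times b to the number of its `false`
  -- entries.
  outcomes : ∀ k → List (Vec Bool k)
  outcomes zero    = [] ∷ []
  outcomes (suc k) = copies a (map (true ∷_) (outcomes k)) ++ copies b (map (false ∷_) (outcomes k))

  ∑-outcomes : ∀ k (f : Vec Bool (suc k) → ℕ) → ∑ f (outcomes (suc k))
             ≡ a * ∑ (f ∘ (true ∷_)) (outcomes k) + b * ∑ (f ∘ (false ∷_)) (outcomes k)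
  ∑-outcomes k f = trans (∑-++ f (copies a (map (true ∷_) (outcomes k))) _) (cong₂ _+_ (part a true) (part b false))
    where
    part : ∀ m x → ∑ f (copies m (map (x ∷_) (outcomes k))) ≡ m * ∑ (f ∘ (x ∷_)) (outcomes k)
    part m x = trans (∑-copies f m _) (cong (m *_) (∑-map f (x ∷_) (outcomes k)))

  ∑-const : ∀ k x → ∑ (const x) (outcomes k) ≡ x * c ^ k
  ∑-const zero    x = trans (+-identityʳ x) (sym (*-identityʳ x))
  ∑-const (suc k) x = trans (∑-outcomes k (const x))
    (trans (cong₂ (λ y z → a * y + b * z) (∑-const k x) (∑-const k x)) (total a b x (c ^ k)))

  length-outcomes : ∀ k → length (outcomes k) ≡ c ^ k
  length-outcomes k = trans (sym (∑-const-1 (outcomes k))) (trans (∑-const k 1) (*-identityˡ _))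

  ∑-none : ∀ k → ∑ (𝟙 ∘ none) (outcomes k) ≡ b ^ k
  ∑-none zero    = refl
  ∑-none (suc k) = trans (∑-outcomes k (𝟙 ∘ none))
    (cong₂ _+_ (trans (cong (a *_) (∑-const k 0)) (*-zeroʳ a)) (cong (b *_) (∑-none k)))

  marginal : ∀ k (i : Fin (suc k)) (g : Bool → ℕ) →
             ∑ (λ ω → g (lookup ω i)) (outcomes (suc k)) ≡ (a * g true + b * g false) * c ^ k
  marginal k zero g = trans (∑-outcomes k _)
    (trans (cong₂ (λ y z → a * y + b * z) (∑-const k (g true)) (∑-const k (g false))) (eq a b (g true) (g false) (c ^ k)))
    where
    eq : ∀ a b t f y → a * (t * y) + b * (f * y) ≡ (a * t + b * f) * y
    eq = solve-∀
  marginal (suc k) (suc i) g = trans (∑-outcomes (suc k) _)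
    (trans (cong₂ (λ y z → a * y + b * z) (marginal k i g) (marginal k i g)) (total a b (a * g true + b * g false) (c ^ k)))

  -- Coordinates are summed out until one of the two is the head, and `marginal` handles the other.
  -- The patterns true-false and false-true each have weight a b out of c².
  joint : ∀ k (i j : Fin (2 + k)) → i ≢ j → ∑ (λ ω → 𝟙 (lookup ω i xor lookup ω j)) (outcomes (2 + k)) ≡ 2 * (a * b) * c ^ k
  joint k zero zero i≢j = contradiction refl i≢j
  joint k zero (suc j) _ = trans (∑-outcomes (suc k) _)
    (trans (cong₂ (λ y z → a * y + b * z) (marginal k j (𝟙 ∘ not)) (marginal k j 𝟙)) (mixed a b (c ^ k)))
  joint k (suc i) zero _ = trans (∑-outcomes (suc k) _)
    (trans (cong₂ (λ y z → a * y + b * z) (marginal k i (λ x → 𝟙 (x xor true))) (marginal k i (λ x → 𝟙 (x xor false)))) (mixed a b (c ^ k)))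
  joint zero (suc zero) (suc zero) i≢j = contradiction refl i≢j
  joint (suc k) (suc i) (suc j) i≢j = trans (∑-outcomes (2 + k) _)
    (trans (cong₂ (λ y z → a * y + b * z) ih ih) (total a b (2 * (a * b)) (c ^ k)))
    where
    ih = joint k i j (i≢j ∘ cong suc)

-- The two spare coordinates avoid a case distinction on the number of vertices in the counts.
far : ∀ {n} → Vec Bool (2 + n) → Fin n → Bool
far ω v = lookup ω (suc (suc v)) ∨ none ω

-- The two events on the left exclude each other, so redefining the outcome `none` adds its full
-- weight b^N to the probability of being far.
far-count : ∀ {n} (ω : Vec Bool (2 + n)) v → 𝟙 (lookup ω (suc (suc v))) + 𝟙 (none ω) ≡ 𝟙 (far ω v)
far-count ω v with none ω in eq
... | true rewrite none⇒false ω eq (suc (suc v)) = refl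
... | false with lookup ω (suc (suc v))
... | true  = refl
... | false = refl

-- Differing coordinates rule out `none`, so `far` then agrees with the coordinates: the
-- redefinition costs the sibling case nothing.
far-≢ : ∀ {n} (ω : Vec Bool (2 + n)) u v → (lookup ω (suc (suc u)) xor lookup ω (suc (suc v))) ≡ true → far ω u ≢ far ω v
far-≢ ω u v xor≡ eq with none ω in none≡
... | true rewrite none⇒false ω none≡ (suc (suc u)) | none⇒false ω none≡ (suc (suc v)) = contradiction xor≡ λ ()
... | false with lookup ω (suc (suc u)) | lookup ω (suc (suc v))
... | true  | false = contradiction eq λ ()
... | false | true  = contradiction eq λ ()

-- Counting separations over the orderings of a rooted tree

module _ (G : Graph) where
  private
    V = Fin (n G)

  indicator : (a b c d : V) → Ordering G → ℕ
  indicator a b c d σ = 𝟙 (separates {G} σ a b c d)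

  PosBelow : Ordering G → (a b c d : V) → Set
  PosBelow σ a b c d = (p a < p c × p a < p d) × (p b < p c × p b < p d)
    where p = pos {G} σ

  PosApart : Ordering G → (a b c d : V) → Set
  PosApart σ a b c d = PosBelow σ a b c d ⊎ PosBelow σ c d a b

  separated : ∀ σ {a b c d} → PosApart σ a b c d → 1 ≤ indicator a b c d σ
  separated σ {a} {b} {c} {d} apart = count (from apart)
    where
    p = pos {G} σ
    max<min : ∀ {a b c d} → PosBelow σ a b c d → ((p a ⊔ p b) <ᵇ (p c ⊓ p d)) ≡ true
    max<min ((ac , ad) , (bc , bd)) =
      Equivalence.to T-≡ (<⇒<ᵇ (⊔-pres-<m (⊓-pres-m< ac ad) (⊓-pres-m< bc bd)))
    from : PosApart σ a b c d → separates {G} σ a b c d ≡ true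
    from (inj₁ lt) rewrite max<min lt = refl
    from (inj₂ gt) rewrite max<min gt = ∨-zeroʳ _
    count : ∀ {x} → x ≡ true → 1 ≤ 𝟙 x
    count refl = s≤s z≤n

  swap₁₂ : ∀ σ {a b c d} → PosApart σ a b c d → PosApart σ b a c d
  swap₁₂ σ (inj₁ (x , y)) = inj₁ (y , x)
  swap₁₂ σ (inj₂ ((x , y) , (z , w))) = inj₂ ((y , x) , (w , z))

  swap₃₄ : ∀ σ {a b c d} → PosApart σ a b c d → PosApart σ a b d c
  swap₃₄ σ (inj₁ ((x , y) , (z , w))) = inj₁ ((y , x) , (w , z))
  swap₃₄ σ (inj₂ (x , y)) = inj₂ (y , x)

module TreeOrderings {G : Graph} (R : Rooting G) where
  open Rooting R
  private
    V = Fin (n G)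

  key : Bool → Vec Bool (2 + n G) → V → List _
  key d ω v = tokens (far ω) d true (rootPath v)

  module Rank (d : Bool) (ω : Vec Bool (2 + n G)) = Ranking (lex-strictTotalOrder ℤ.<-strictTotalOrder) (key d ω)
    (λ eq → rootPath-inj (tokens-injective (far ω) d true (Pointwise-≡⇒≡ eq)))

  ordering : Bool → Vec Bool (2 + n G) → Ordering G
  ordering d ω = Rank.ranking d ω

  Sep⇒PosApart : ∀ d ω a b c d′ → Sep (far ω) d true (rootPath a) (rootPath b) (rootPath c) (rootPath d′) →
                 PosApart G (ordering d ω) a b c d′
  Sep⇒PosApart d ω a b c d′ (inj₁ ((x , y) , (z , w))) = inj₁ ((m x , m y) , (m z , m w))
    where
    m : ∀ {u v} → _ → _
    m {u} {v} = Rank.rank-mono d ω {u} {v}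
  Sep⇒PosApart d ω a b c d′ (inj₂ ((x , y) , (z , w))) = inj₂ ((m x , m y) , (m z , m w))
    where
    m : ∀ {u v} → _ → _
    m {u} {v} = Rank.rank-mono d ω {u} {v}

  -- The two cases of `Config` in terms of positions, with the ends of each edge in any order
  -- instead of parent first.
  data Profile (a b c d : V) : Set where
    chain   : ∀ z → (∀ e ω → far ω z ≡ true → PosApart G (ordering e ω) a b c d) → Profile a b c d
    sibling : ∀ x y → x ≢ y →
              (∀ e ω → far ω x ≢ far ω y → PosApart G (ordering e ω) a b c d) →
              ∀ e → (∀ ω → PosApart G (ordering e ω) a b c d) → Profile a b c d

  Profile-map : ∀ {a b c d a′ b′ c′ d′} → (∀ σ → PosApart G σ a b c d → PosApart G σ a′ b′ c′ d′) →
                Profile a b c d → Profile a′ b′ c′ d′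
  Profile-map f (chain z sep) = chain z λ e ω fz → f (ordering e ω) (sep e ω fz)
  Profile-map f (sibling x y x≢y sep e sep-e) = sibling x y x≢y (λ e ω f≢ → f (ordering e ω) (sep e ω f≢)) e (λ ω → f (ordering e ω) (sep-e ω))

  profile-down : ∀ {a b c d} → rootPath b ≡ rootPath a ∷ʳ b → rootPath d ≡ rootPath c ∷ʳ d →
                 a ≢ c → a ≢ d → b ≢ c → Profile a b c d
  profile-down {a} {b} {c} {d} ab cd a≢c a≢d b≢c
    with config (rootPath a) b (rootPath c) d
           (a≢c ∘ rootPath-inj)
           (λ eq → b≢c (rootPath-inj (trans ab eq)))
           (λ eq → a≢d (sym (rootPath-inj (trans cd eq))))
  ... | cfg rewrite sym ab | sym cd with cfg
  ...   | chain z sep = chain z λ e ω fz → Sep⇒PosApart e ω a b c d (sep (far ω) e true fz)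
  ...   | sibling x y x≢y sep e sep-e = sibling x y x≢y
            (λ e ω f≢ → Sep⇒PosApart e ω a b c d (sep (far ω) e true f≢)) e
            (λ ω → Sep⇒PosApart e ω a b c d (sep-e (far ω) true))

  profile : ∀ {a b c d} → Adj G a b → Adj G c d → a ≢ c → a ≢ d → b ≢ c → b ≢ d → Profile a b c d
  profile {a} {b} {c} {d} e f a≢c a≢d b≢c b≢d with adj⇒child e | adj⇒child f
  ... | inj₁ ab | inj₁ cd = profile-down ab cd a≢c a≢d b≢c
  ... | inj₁ ab | inj₂ dc = Profile-map (λ σ → swap₃₄ G σ {a} {b} {d} {c}) (profile-down ab dc a≢d a≢c b≢d)
  ... | inj₂ ba | inj₁ cd = Profile-map (λ σ → swap₁₂ G σ {b} {a} {c} {d}) (profile-down ba cd b≢c b≢d a≢c)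
  ... | inj₂ ba | inj₂ dc = Profile-map (λ σ → swap₁₂ G σ {b} {a} {c} {d} ∘ swap₃₄ G σ {b} {a} {d} {c})
                                        (profile-down ba dc b≢d b≢c a≢d)

  module _ (a b : ℕ) where
    open Outcomes a b
    private
      N = 2 + n G
      c = a + b

    orderings : List (Ordering G)
    orderings = map (ordering true) (outcomes N) ++ map (ordering false) (outcomes N)

    length-orderings : length orderings ≡ 2 * c ^ N
    length-orderings = trans (length-++ (map (ordering true) (outcomes N)))
      (cong₂ _+_ (half true) (trans (half false) (sym (+-identityʳ _))))
      where
      half : ∀ d → length (map (ordering d) (outcomes N)) ≡ c ^ N
      half d = trans (length-map (ordering d) (outcomes N)) (length-outcomes N)

    -- Divided by the 2 c^N orderings, these are a / c + (b / c)^N and 1/2 + (a / c) (b / c).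
    chainCount siblingCount : ℕ
    chainCount   = 2 * (a * c ^ (1 + n G) + b ^ N)
    siblingCount = c ^ N + 2 * (a * b) * c ^ n G

    module _ {u v x y : V} where
      private
        sep : Bool → Vec Bool N → ℕ
        sep e ω = indicator G u v x y (ordering e ω)

      sepCount-orderings : sepCount {G} orderings u v x y ≡ ∑ (λ ω → sep true ω + sep false ω) (outcomes N)
      sepCount-orderings = trans (∑-++ (indicator G u v x y) (map (ordering true) (outcomes N)) _)
        (trans (cong₂ _+_ (∑-map _ (ordering true) (outcomes N)) (∑-map _ (ordering false) (outcomes N)))
               (sym (∑-+ (sep true) (sep false) (outcomes N))))

      profile⇒count : Profile u v x y → chainCount ⊓ siblingCount ≤ sepCount {G} orderings u v x y
      profile⇒count (chain z apart) = ≤-trans (m⊓n≤m chainCount siblingCount) (begin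
        chainCount
          ≡⟨ cong (2 *_) (sym (cong₂ _+_ (trans (marginal (1 + n G) (suc (suc z)) 𝟙) (eq a b (c ^ (1 + n G)))) (∑-none N))) ⟩
        2 * (∑ (λ ω → 𝟙 (lookup ω (suc (suc z)))) (outcomes N) + ∑ (𝟙 ∘ none) (outcomes N))
          ≡⟨ cong (2 *_) (sym (∑-+ _ _ (outcomes N))) ⟩
        2 * ∑ (λ ω → 𝟙 (lookup ω (suc (suc z))) + 𝟙 (none ω)) (outcomes N)
          ≤⟨ *-monoʳ-≤ 2 (∑-mono (λ ω → ≤-reflexive (far-count ω z)) (outcomes N)) ⟩
        2 * ∑ (λ ω → 𝟙 (far ω z)) (outcomes N)
          ≡⟨ cong (∑ (λ ω → 𝟙 (far ω z)) (outcomes N) +_) (+-identityʳ _) ⟩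
        ∑ (λ ω → 𝟙 (far ω z)) (outcomes N) + ∑ (λ ω → 𝟙 (far ω z)) (outcomes N)
          ≤⟨ +-mono-≤ (∑-mono (bound true) (outcomes N)) (∑-mono (bound false) (outcomes N)) ⟩
        ∑ (sep true) (outcomes N) + ∑ (sep false) (outcomes N)
          ≡⟨ trans (sym (∑-+ (sep true) (sep false) (outcomes N))) (sym sepCount-orderings) ⟩
        sepCount {G} orderings u v x y ∎)
        where
        open ≤-Reasoning
        eq : ∀ a b y → (a * 1 + b * 0) * y ≡ a * y
        eq = solve-∀
        bound : ∀ e ω → 𝟙 (far ω z) ≤ sep e ω
        bound e ω with far ω z in fz
        ... | true  = separated G (ordering e ω) {u} {v} {x} {y} (apart e ω fz)
        ... | false = z≤n
      profile⇒count (sibling i j i≢j apart e apart-e) = ≤-trans (m⊓n≤n chainCount siblingCount) (begin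
        siblingCount
          ≡⟨ sym (cong₂ _+_ (trans (∑-const N 1) (*-identityˡ _)) (joint (n G) _ _ (i≢j ∘ Fin.suc-injective ∘ Fin.suc-injective))) ⟩
        ∑ (const 1) (outcomes N) + ∑ differ (outcomes N)
          ≡⟨ sym (∑-+ (const 1) differ (outcomes N)) ⟩
        ∑ (λ ω → 1 + differ ω) (outcomes N)
          ≤⟨ ∑-mono bound (outcomes N) ⟩
        ∑ (λ ω → sep true ω + sep false ω) (outcomes N)
          ≡⟨ sym sepCount-orderings ⟩
        sepCount {G} orderings u v x y ∎)
        where
        open ≤-Reasoning
        differ : Vec Bool N → ℕ
        differ ω = 𝟙 (lookup ω (suc (suc i)) xor lookup ω (suc (suc j)))
        one : ∀ e → (∀ ω → PosApart G (ordering e ω) u v x y) → ∀ ω → 1 ≤ sep true ω + sep false ω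
        one true  ap ω = ≤-trans (separated G (ordering true ω) {u} {v} {x} {y} (ap ω)) (m≤m+n _ _)
        one false ap ω = ≤-trans (separated G (ordering false ω) {u} {v} {x} {y} (ap ω)) (m≤n+m _ (sep true ω))
        -- One value of the coin always separates, which accounts for the 1; when the coordinates of
        -- i and j differ, both values do.
        bound : ∀ ω → 1 + differ ω ≤ sep true ω + sep false ω
        bound ω with lookup ω (suc (suc i)) xor lookup ω (suc (suc j)) in xor≡
        ... | true  = +-mono-≤ (separated G (ordering true ω) {u} {v} {x} {y} (apart true ω (far-≢ ω i j xor≡)))
                               (separated G (ordering false ω) {u} {v} {x} {y} (apart false ω (far-≢ ω i j xor≡)))
        ... | false = one e apart-e ω

    orderings-separate : SeparatesAll G (chainCount ⊓ siblingCount) orderings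
    orderings-separate u v x y uv xy u≢x u≢y v≢x v≢y =
      profile⇒count (profile uv xy u≢x u≢y v≢x v≢y)

-- Attaining the minimum

insert-cong : ∀ {n} j {π ρ : Permutation′ n} → π ≈ ρ → insert zero j π ≈ insert zero j ρ
insert-cong j π≈ρ zero    = refl
insert-cong j π≈ρ (suc i) = cong (punchIn j) (π≈ρ i)

-- A permutation is split into the image of `zero` and a smaller permutation. Reassembling recovers
-- it only up to `≈`, so the predicate has to respect `≈`.
permutation-search : ∀ n (P : Permutation′ n → Set) → (∀ π → Dec (P π)) →
                     (∀ {π ρ} → π ≈ ρ → P π → P ρ) → Dec (∃ P)
permutation-search zero P P? resp = map′ (idₚ ,_) (λ { (π , Pπ) → resp (λ ()) Pπ }) (P? idₚ)
permutation-search (suc n) P P? resp =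
  map′ (λ { (j , π , Pπ) → insert zero j π , Pπ })
       (λ { (π , Pπ) → π ⟨$⟩ʳ zero , remove zero π , resp (λ i → sym (insert-remove zero π i)) Pπ })
       (any? λ j → permutation-search n (P ∘ insert zero j) (P? ∘ insert zero j) (resp ∘ insert-cong j))

list-search : ∀ {n} k (P : List (Permutation′ n) → Set) → (∀ πs → Dec (P πs)) →
              (∀ {πs ρs} → Pointwise _≈_ πs ρs → P πs → P ρs) → Dec (∃ λ πs → length πs ≡ k × P πs)
list-search zero P P? resp = map′ (λ p → [] , refl , p) (λ { ([] , _ , p) → p }) (P? [])
list-search (suc k) P P? resp =
  map′ (λ { (π , πs , eq , p) → π ∷ πs , cong suc eq , p })
       (λ { (π ∷ πs , eq , p) → π , πs , suc-injective eq , p })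
       (permutation-search _ _
         (λ π → list-search k (P ∘ (π ∷_)) (P? ∘ (π ∷_)) (λ πs≈ → resp ((λ _ → refl) ∷ πs≈)))
         (λ { π≈ρ (πs , eq , p) → πs , eq , resp (π≈ρ ∷ Pointwise-refl πs) p }))
  where
  Pointwise-refl : ∀ πs → Pointwise _≈_ πs πs
  Pointwise-refl []       = []
  Pointwise-refl (π ∷ πs) = (λ _ → refl) ∷ Pointwise-refl πs

least : ∀ {P : ℕ → Set} → (∀ k → Dec (P k)) → ∀ L → P L → ∃ λ m → m ≤ L × P m × (∀ k → k < m → ¬ P k)
least {P} P? L PL = [ (λ none → L , ≤-refl , PL , none) , (λ { (m , m<L , Pm , min) → m , <⇒≤ m<L , Pm , min }) ]′ (below L)
  where
  below : ∀ L → (∀ k → k < L → ¬ P k) ⊎ (∃ λ m → m < L × P m × (∀ k → k < m → ¬ P k))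
  below zero = inj₁ λ _ ()
  below (suc L) with below L
  ... | inj₂ (m , m<L , Pm , min) = inj₂ (m , m<n⇒m<1+n m<L , Pm , min)
  ... | inj₁ none with P? L
  ...   | yes PL = inj₂ (L , n<1+n L , PL , none)
  ...   | no ¬PL = inj₁ λ { k k<1+L Pk → [ (λ k<L → none k k<L Pk) , (λ { refl → ¬PL Pk }) ]′ (m≤n⇒m<n∨m≡n (s≤s⁻¹ k<1+L)) }

module _ {G : Graph} (adj? : ∀ u v → Dec (Adj G u v)) where

  separatesAll? : ∀ t σs → Dec (SeparatesAll G t σs)
  separatesAll? t σs =
    all? λ a → all? λ b → all? λ c → all? λ d →
      adj? a b →-dec adj? c d →-dec ¬? (a ≟ c) →-dec ¬? (a ≟ d) →-dec
      ¬? (b ≟ c) →-dec ¬? (b ≟ d) →-dec (t ≤? sepCount {G} σs a b c d)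

  sepCount-cong : ∀ {σs τs : List (Ordering G)} a b c d → Pointwise _≈_ σs τs →
                  sepCount {G} σs a b c d ≡ sepCount {G} τs a b c d
  sepCount-cong a b c d [] = refl
  sepCount-cong a b c d (_∷_ {x = σ} {y = τ} σ≈τ σs≈τs) = cong₂ _+_ same (sepCount-cong a b c d σs≈τs)
    where
    same : indicator G a b c d σ ≡ indicator G a b c d τ
    same rewrite σ≈τ a | σ≈τ b | σ≈τ c | σ≈τ d = refl

  -- A given separating list bounds the search: for each length there are finitely many lists up to
  -- `≈`, and the least successful length is π_t.
  piT : ∀ t σs → SeparatesAll G t σs → ∃ λ m → m ≤ length σs × IsPiT G t m
  piT t σs sep
    with m , m≤L , attained , minimal ← least
           (λ k → list-search k (SeparatesAll G t) (separatesAll? t)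
             (λ σs≈τs sep a b c d e f a≢c a≢d b≢c b≢d →
               subst (t ≤_) (sepCount-cong a b c d σs≈τs) (sep a b c d e f a≢c a≢d b≢c b≢d)))
           (length σs) (σs , refl , sep) =
    m , m≤L , attained , λ τs sep′ → ≮⇒≥ λ short → minimal (length τs) short (τs , refl , sep′)

  -- Repeating the list k times multiplies both its length and the guaranteed count by k, so the
  -- ratio L / t bounds π_s / s at every positive multiple s of t.
  fracSepLtSqrt2 : ∀ t σs → SeparatesAll G t σs → square (length σs) < 2 * square t → FracSepLtSqrt2 G
  fracSepLtSqrt2 t σs sep L²<2t² = conclude (between L t L²<2t²)
    where
    L = length σs
    0<t : 0 < t
    0<t = n≢0⇒n>0 λ { refl → contradiction L²<2t² λ () }

    sep-copies : ∀ k → SeparatesAll G (k * t) (copies k σs)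
    sep-copies k a b c d e f a≢c a≢d b≢c b≢d =
      ≤-trans (*-monoʳ-≤ k (sep a b c d e f a≢c a≢d b≢c b≢d))
              (≤-reflexive (sym (∑-copies (indicator G a b c d) k σs)))

    witness : ∀ p q → L * q < p * t → ∀ N → (∃ λ m → m ≤ length (copies (suc N) σs) × IsPiT G (suc N * t) m) →
              Σ ℕ λ s → (N < s) × Σ ℕ λ m → IsPiT G s m × (m * q < p * s)
    -- Since t is positive, the multiple `suc N * t` exceeds N.
    witness p q Lq<pt N (m , m≤ , πₜ) = suc N * t , m≤m*n (suc N) t {{>-nonZero 0<t}} , m , πₜ , (begin-strict
      m * q             ≤⟨ *-monoˡ-≤ q (subst (m ≤_) (length-copies (suc N) σs) m≤) ⟩
      suc N * L * q     ≡⟨ *-assoc (suc N) L q ⟩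
      suc N * (L * q)   <⟨ *-monoʳ-< (suc N) Lq<pt ⟩
      suc N * (p * t)   ≡⟨ eq (suc N) p t ⟩
      p * (suc N * t)   ∎)
      where
      open ≤-Reasoning
      eq : ∀ k p t → k * (p * t) ≡ p * (k * t)
      eq = solve-∀

    conclude : (∃ λ p → ∃ λ q → 0 < q × square p < 2 * square q × L * q < p * t) → FracSepLtSqrt2 G
    conclude (p , q , 0<q , p²<2q² , Lq<pt) = p , q , 0<q , p²<2q² ,
      λ N → witness p q Lq<pt N (piT (suc N * t) (copies (suc N) σs) (sep-copies (suc N)))

-- The bound below √2 for trees

rooting⇒fracSepLtSqrt2 : ∀ {G} → Rooting G → PellPair (2 + n G) → FracSepLtSqrt2 G
rooting⇒fracSepLtSqrt2 {G} R P =
  fracSepLtSqrt2 {G} adj? t (orderings a b) (orderings-separate a b)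
    (subst (λ L → square L < 2 * square t) (sym (length-orderings a b)) bound)
  where
  open Rooting R using (adj?)
  open TreeOrderings R
  open PellPair P
  t = chainCount a b ⊓ siblingCount a b

  bound : square (2 * (a + b) ^ (2 + n G)) < 2 * square t
  -- The guaranteed count is the smaller of the two, hence equal to one of them, and each of them
  -- beats the bound.
  bound = [ (λ eq → via eq chains) , (λ eq → via eq siblings) ]′ (⊓-sel (chainCount a b) (siblingCount a b))
    where
    via : ∀ {s L} → t ≡ s → L < 2 * square s → L < 2 * square t
    via {L = L} t≡s = subst (λ s → L < 2 * square s) (sym t≡s)

    chains : square (2 * (a + b) ^ (2 + n G)) < 2 * square (chainCount a b)
    chains = chainBound a (a + b) ((a + b) ^ (1 + n G)) (b ^ (2 + n G)) pell (c^1+n≤4ab^n+2 P)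
               (m^n>0 b {{>-nonZero 0<b}} (2 + n G))

    siblings : square (2 * (a + b) ^ (2 + n G)) < 2 * square (siblingCount a b)
    siblings = siblingBound a b ((a + b) ^ n G) pell b≤a
                 (m^n>0 (a + b) {{>-nonZero (≤-trans 0<b (m≤n+m b a))}} (n G))

mainTheorem7 : (G : Graph) → IsTree G → FracSepLtSqrt2 G
-- The index is the number of random coordinates; it gives c ≥ 2^(n+2), on which the comparison of
-- c^n with b^(n+2) rests.
mainTheorem7 G tree = rooting⇒fracSepLtSqrt2 (rooting G tree) (pellPair (2 + n G))
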